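{- Let $s\ge0$ be an integer. For $n\ge0$ let $S_s(n)$ be the number of $\approx_s$-classes of $\{\mathtt a,\mathtt b\}^n$ having exactly one element, and let $\mathcal S_s(x)=\sum_{n\ge0}S_s(n)x^n$. Then $$\mathcal S_s(x)=\sum_{j=0}^{s}\frac{x^j}{(1-x)^{j+1}}+\frac{x^{s+1}(1+x)(1+2x^2)}{(1-x)^{s+2}}.$$
   Context: For words over $\{\mathtt a,\mathtt b\}$, $|w|_{\mathtt a}$ is the number of letters $\mathtt a$ in $w$ and $\binom{w}{\mathtt{ab}}$ the number of occurrences of $\mathtt{ab}$ as a scattered subword. For $u,w\in\{\mathtt a,\mathtt b\}^n$: $u\sim_2w$ iff $|u|_{\mathtt a}=|w|_{\mathtt a}$ and $\binom{u}{\mathtt{ab}}=\binom{w}{\mathtt{ab}}$. Let $r_i$ be the number of $\mathtt b$'s to the right of the $i$-th $\mathtt a$ of $w$, and $\ell=\min(s,|w|_{\mathtt a})$; the $s$-tail is $\mathcal T_s(w)=(r_{|w|_{\mathtt a}},r_{|w|_{\mathtt a}-1},\dots,r_{|w|_{\mathtt a}-\ell+1})$ (empty if $\ell=0$). Define $u\approx_sw$ iff $u\sim_2w$ and $\mathcal T_s(u)=\mathcal T_s(w)$. The identity is one of formal power series in $x$. -}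

module Defs where

open import Algebra.Bundles.Raw using (RawRing)
import Algebra.Definitions.RawSemiring as RawSemiringDefinitions
open import Data.Bool.Base using (if_then_else_)
open import Data.Fin.Base using (Fin; zero; suc; toℕ)
open import Data.Integer.Base as ℤ using (ℤ; 0ℤ; 1ℤ)
import Data.Integer.Properties as ℤ
open import Data.List.Base as List using (List; []; _∷_; [_]; _++_)
import Data.List.Properties as List
open import Data.Nat.Base as ℕ using (ℕ; zero; suc; _∸_)
import Data.Nat.Properties as ℕ
open import Data.Product.Base using (_×_)
open import Data.Vec.Base as Vec using (Vec; []; _∷_)
import Data.Vec.Properties as Vec
open import Function.Base using (_∘_)
open import Level using (0ℓ)
open import Relation.Binary.Definitions using (DecidableEquality)
open import Relation.Binary.PropositionalEquality
  using (_≡_; _≗_; refl; trans; cong; cong₂; module ≡-Reasoning)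
open import Relation.Nullary.Decidable using (Dec; yes; no; does; _×-dec_)

data Letter : Set where
  a b : Letter

_≟_ : DecidableEquality Letter
a ≟ a = yes refl
a ≟ b = no λ ()
b ≟ a = no λ ()
b ≟ b = yes refl

Word : ℕ → Set
Word = Vec Letter

_≟ʷ_ : ∀ {n} → DecidableEquality (Word n)
_≟ʷ_ = Vec.≡-dec _≟_

words : ∀ n → List (Word n)
words zero    = [ [] ]
words (suc n) = List.map (a ∷_) (words n) ++ List.map (b ∷_) (words n)

∣_∣[_] : ∀ {n} → Word n → Letter → ℕ
∣ w ∣[ x ] = Vec.count (_≟ x) w

-- The number of occurrences of v as a scattered subword of w; the occurrences
-- are split by whether they use the first letter of w.
binom : ∀ {m n} → Word n → Word m → ℕ
binom w       []      = 1
binom []      (y ∷ v) = 0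
binom (x ∷ w) (y ∷ v) =
  (if does (x ≟ y) then binom w v else 0) ℕ.+ binom w (y ∷ v)

ab : Word 2
ab = a ∷ b ∷ []

infix 4 _∼₂_ _∼₂?_

_∼₂_ : ∀ {n} → Word n → Word n → Set
u ∼₂ w = ∣ u ∣[ a ] ≡ ∣ w ∣[ a ] × binom u ab ≡ binom w ab

_∼₂?_ : ∀ {n} (u w : Word n) → Dec (u ∼₂ w)
u ∼₂? w = (∣ u ∣[ a ] ℕ.≟ ∣ w ∣[ a ]) ×-dec (binom u ab ℕ.≟ binom w ab)

-- r₁ , r₂ , … , where rᵢ is the number of b's to the right of the i-th a.
rights : ∀ {n} → Word n → List ℕ
rights []      = []
rights (a ∷ w) = ∣ w ∣[ b ] ∷ rights w
rights (b ∷ w) = rights w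

-- `take` stops at the end of the list, which accounts for ℓ = min(s, |w|ₐ).
tail : ∀ {n} → ℕ → Word n → List ℕ
tail s w = List.take s (List.reverse (rights w))

infix 4 _≈[_]_ _≈[_]?_

_≈[_]_ : ∀ {n} → Word n → ℕ → Word n → Set
u ≈[ s ] w = u ∼₂ w × tail s u ≡ tail s w

_≈[_]?_ : ∀ {n} (u : Word n) s (w : Word n) → Dec (u ≈[ s ] w)
u ≈[ s ]? w = (u ∼₂? w) ×-dec List.≡-dec ℕ._≟_ (tail s u) (tail s w)

class : ∀ {n} → ℕ → Word n → List (Word n)
class {n} s w = List.filter (λ u → u ≈[ s ]? w) (words n)

-- Each class is listed in the order of `words n`, so two classes are equal as
-- sets exactly when they are equal as lists.
classes : ℕ → ∀ n → List (List (Word n))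
classes s n = List.deduplicate (List.≡-dec _≟ʷ_) (List.map (class s) (words n))

S : ℕ → ℕ → ℕ
S s n = List.length (List.filter (λ c → List.length c ℕ.≟ 1) (classes s n))

-- Formal power series with integer coefficients; equality is _≗_.
Series : Set
Series = ℕ → ℤ

𝒮 : ℕ → Series
𝒮 s n = ℤ.+ S s n

private
  module Σℤ = RawSemiringDefinitions ℤ.+-*-rawSemiring

infixl 6 _+_ _-_
infixl 7 _*_ _/_

const : ℤ → Series
const c zero    = c
const c (suc n) = 0ℤ

0# 1# x : Series
0# = const 0ℤ
1# = const 1ℤ
x zero    = 0ℤ
x (suc n) = 1# n

_+_ _-_ _*_ : Series → Series → Series
(f + g) n = f n ℤ.+ g n
(f - g) n = f n ℤ.- g n
(f * g) n = Σℤ.sum {suc n} λ i → f (toℕ i) ℤ.* g (n ∸ toℕ i)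

rawRing : RawRing 0ℓ 0ℓ
rawRing = record
  { Carrier = Series
  ; _≈_     = _≗_
  ; _+_     = _+_
  ; _*_     = _*_
  ; -_      = λ f n → ℤ.- f n
  ; 0#      = 0#
  ; 1#      = 1#
  }

open RawSemiringDefinitions (RawRing.rawSemiring rawRing) public
  using (_^_; sum)

-- The coefficients hₙ , … , h₀ of h = 1/g, from h₀ = 1 and
-- hₙ₊₁ = - (g₁hₙ + … + gₙ₊₁h₀). This is the inverse of g when g₀ = 1.
inverseCoeffs : Series → ∀ n → Vec ℤ (suc n)
inverseCoeffs g zero    = 1ℤ ∷ []
inverseCoeffs g (suc n) =
  ℤ.- Σℤ.sum (λ i → g (suc (toℕ i)) ℤ.* Vec.lookup hs i) ∷ hs
  where hs = inverseCoeffs g n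

inverse : Series → Series
inverse g n = Vec.head (inverseCoeffs g n)

_/_ : Series → Series → Series
f / g = f * inverse g

private
  lookup-inverseCoeffs : ∀ g n (i : Fin (suc n)) →
    Vec.lookup (inverseCoeffs g n) i ≡ inverse g (n ∸ toℕ i)
  lookup-inverseCoeffs g zero    zero    = refl
  lookup-inverseCoeffs g (suc n) zero    = refl
  lookup-inverseCoeffs g (suc n) (suc i) = lookup-inverseCoeffs g n i

  sum-cong : ∀ {n} {f g : Fin n → ℤ} → f ≗ g → Σℤ.sum f ≡ Σℤ.sum g
  sum-cong {zero}  f≗g = refl
  sum-cong {suc n} f≗g = cong₂ ℤ._+_ (f≗g zero) (sum-cong (f≗g ∘ suc))

*-inverseʳ : ∀ g → g 0 ≡ 1ℤ → g * inverse g ≗ 1#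
*-inverseʳ g g₀≡1 zero    =
  trans (ℤ.+-identityʳ _) (trans (ℤ.*-identityʳ (g 0)) g₀≡1)
*-inverseʳ g g₀≡1 (suc n) = begin
  g 0 ℤ.* inverse g (suc n) ℤ.+ Σ′  ≡⟨ cong (λ c → c ℤ.* inverse g (suc n) ℤ.+ Σ′) g₀≡1 ⟩
  1ℤ ℤ.* inverse g (suc n) ℤ.+ Σ′   ≡⟨ cong (ℤ._+ Σ′) (ℤ.*-identityˡ (inverse g (suc n))) ⟩
  inverse g (suc n) ℤ.+ Σ′          ≡⟨ cong (λ c → ℤ.- c ℤ.+ Σ′) (sum-cong λ i →
                                         cong (g (suc (toℕ i)) ℤ.*_) (lookup-inverseCoeffs g n i)) ⟩
  ℤ.- Σ′ ℤ.+ Σ′                     ≡⟨ ℤ.+-inverseˡ Σ′ ⟩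
  0ℤ                                ∎
  where
  open ≡-Reasoning
  Σ′ : ℤ
  Σ′ = Σℤ.sum {suc n} λ i → g (suc (toℕ i)) ℤ.* inverse g (n ∸ toℕ i)

[1-x]^k₀≡1 : ∀ k → ((1# - x) ^ k) 0 ≡ 1ℤ
[1-x]^k₀≡1 zero    = refl
[1-x]^k₀≡1 (suc k) = trans (ℤ.+-identityʳ _)
  (trans (ℤ.*-identityˡ (((1# - x) ^ k) 0)) ([1-x]^k₀≡1 k))

-- A class is a singleton when its word w is isolated: u ≈ₛ w only for u = w.
--
-- Last letter: the first entry of the (s+1)-tail of wa is 0, while that of wb is
-- positive or missing. Hence wa is isolated for s+1 iff w is isolated for s, and
-- wb is isolated for s+1 iff w is, so that S (s+1) (n+1) = S s n + S (s+1) n.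
-- This is 𝒮 (s+1) = v (1 + x 𝒮 s) with v = 1/(1 - x), a recursion that the right
-- hand side satisfies as well.
--
-- First letter, for s = 0: let c ≠ d be the two letters. The occurrences of dc in
-- a word with p letters c and q letters d take every value in 0, … , pq. Hence
-- du ∼₂ cw is solvable for u iff dc occurs in w more than |w|_c times, and cw is
-- isolated iff w is isolated with at most |w|_c occurrences of dc. Iterating this
-- criterion gives S 0 (n+1) = S 0 n + 6 for n ≥ 3.

module Submission where

open import Algebra.Bundles using (CommutativeSemiring)
import Algebra.Construct.Pointwise as Pointwise
import Algebra.Definitions.RawSemiring as RawSemiringDefinitions
open import Algebra.Properties.CommutativeSemigroup using (interchange)
import Algebra.Properties.Semiring.Sum as SemiringSum
import Algebra.Solver.Ring.NaturalCoefficients.Default as Solver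
open import Algebra.Structures.Biased using (isCommutativeSemiringˡ)
open import Data.Bool.Base using (true; false)
open import Data.Empty using (⊥)
open import Data.Fin.Base using (Fin; toℕ)
open import Data.Integer.Base as ℤ using (ℤ; +_; -1ℤ; 0ℤ; 1ℤ)
import Data.Integer.Properties as ℤ
import Data.Integer.Tactic.RingSolver as ℤ-Solver
open import Data.List.Base as List using (List; []; _∷_; [_]; _++_; length; filter; reverse)
open import Data.List.Membership.Propositional using (_∈_)
open import Data.List.Membership.Propositional.Properties
  using (∈-map⁺; ∈-map⁻; ∈-++⁺ˡ; ∈-++⁺ʳ; ∈-filter⁺; ∈-filter⁻; ∈-deduplicate⁺; ∈-deduplicate⁻)
open import Data.List.Membership.Propositional.Properties.WithK using (unique∧set⇒bag)
import Data.List.Properties as List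
open import Data.List.Relation.Binary.BagAndSetEquality using (∼bag⇒↭)
open import Data.List.Relation.Binary.Permutation.Propositional.Properties using (↭-length)
import Data.List.Relation.Unary.All as All
open import Data.List.Relation.Unary.AllPairs using ([]; _∷_)
open import Data.List.Relation.Unary.Any using (here)
open import Data.List.Relation.Unary.Unique.DecPropositional.Properties using (deduplicate-!)
open import Data.List.Relation.Unary.Unique.Propositional using (Unique)
import Data.List.Relation.Unary.Unique.Propositional.Properties as Unique
open import Data.Nat.Base as ℕ using (ℕ; zero; suc; _∸_; _≤_; _<_; z≤n)
import Data.Nat.Properties as ℕ
import Data.Nat.Tactic.RingSolver as ℕ-Solver
open import Data.Product.Base using (_×_; _,_; proj₁; proj₂; ∃-syntax; Σ-syntax)
open import Data.Sum.Base using (_⊎_; inj₁; inj₂)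
open import Data.Vec.Base as Vec using ([]; _∷_; _∷ʳ_)
import Data.Vec.Properties as Vec
open import Function.Base using (_∘_)
open import Function.Bundles using (mk⇔)
open import Level using (Level; 0ℓ)
open import Relation.Binary.PropositionalEquality
  using (_≡_; _≗_; refl; sym; trans; cong; cong₂; subst; isEquivalence; module ≡-Reasoning)
import Relation.Binary.Reasoning.Setoid as SetoidReasoning
open import Relation.Nullary.Decidable using (does; yes; no; map′; _×-dec_)
open import Relation.Nullary.Negation using (contradiction)
open import Relation.Unary using (Pred; Decidable; _≐_)

-- Semiring identities for the right-hand side

module _ (R : CommutativeSemiring 0ℓ 0ℓ) where

  open CommutativeSemiring R renaming (refl to ≋-refl)
  open RawSemiringDefinitions rawSemiring using (_^_; sum)
  open SemiringSum semiring using (*-distribˡ-sum; sum-cong-≋)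
  open Solver R using (solve; _:=_; _:+_; _:*_; con)
  open SetoidReasoning setoid

  -- Serves two purposes: turning a difference equation into a closed form, and, with `1#` for `g`,
  -- uniqueness of inverses.
  *-solve : ∀ {u v f g} → u * v ≈ 1# → u * f ≈ g → f ≈ v * g
  *-solve {u} {v} {f} {g} uv uf = begin
    f            ≈⟨ *-identityˡ f ⟨
    1# * f       ≈⟨ *-congʳ uv ⟨
    u * v * f    ≈⟨ solve 3 (λ u v f → u :* v :* f := v :* (u :* f)) ≋-refl u v f ⟩
    v * (u * f)  ≈⟨ *-congˡ uf ⟩
    v * g        ∎

  ^-inverse : ∀ {u v} → u * v ≈ 1# → ∀ k → u ^ k * v ^ k ≈ 1#
  ^-inverse uv zero    = *-identityˡ 1#
  ^-inverse {u} {v} uv (suc k) = begin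
    u * u ^ k * (v * v ^ k)  ≈⟨ solve 4 (λ u uᵏ v vᵏ → u :* uᵏ :* (v :* vᵏ) := u :* v :* (uᵏ :* vᵏ)) ≋-refl u (u ^ k) v (v ^ k) ⟩
    u * v * (u ^ k * v ^ k)  ≈⟨ *-cong uv (^-inverse uv k) ⟩
    1# * 1#                  ≈⟨ *-identityˡ 1# ⟩
    1#                       ∎

  -- For v = 1/(1 - x) and r = (1 + x)(1 + 2x²) this is the right hand side of the theorem.
  partialGeometric : (v x r : Carrier) → ℕ → Carrier
  partialGeometric v x r s = sum {suc s} (λ j → x ^ toℕ j * v ^ suc (toℕ j)) + x ^ suc s * r * v ^ suc (suc s)

  -- Apart from the summand `v` at `j = 0`, every term for `suc s` is `x * v` times the
  -- corresponding term for `s`, the closing fraction included.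
  partialGeometric-suc : ∀ v x r s →
    partialGeometric v x r (suc s) ≈ v * (1# + x * partialGeometric v x r s)
  partialGeometric-suc v x r s = begin
    1# * (v * 1#) + sum {suc s} (λ j → x * x ^ toℕ j * (v * v ^ suc (toℕ j))) + x * xˢ * r * (v * vˢ)
      ≈⟨ +-congʳ (+-congˡ shift-sum) ⟩
    1# * (v * 1#) + x * v * σ + x * xˢ * r * (v * vˢ)
      ≈⟨ solve 6 (λ v x r σ xˢ vˢ →
           con 1 :* (v :* con 1) :+ x :* v :* σ :+ x :* xˢ :* r :* (v :* vˢ) :=
           v :* (con 1 :+ x :* (σ :+ xˢ :* r :* vˢ))) ≋-refl v x r σ xˢ vˢ ⟩
    v * (1# + x * (σ + xˢ * r * vˢ))  ∎
    where
    xˢ = x ^ suc s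
    vˢ = v ^ suc (suc s)
    t : Fin (suc s) → Carrier
    t j = x ^ toℕ j * v ^ suc (toℕ j)
    σ = sum t
    shift-sum : sum {suc s} (λ j → x * x ^ toℕ j * (v * v ^ suc (toℕ j))) ≈ x * v * σ
    shift-sum = begin
      sum {suc s} (λ j → x * x ^ toℕ j * (v * v ^ suc (toℕ j)))
        ≈⟨ sum-cong-≋ {suc s} (λ j → solve 4 (λ x xʲ v vʲ → x :* xʲ :* (v :* vʲ) := x :* v :* (xʲ :* vʲ)) ≋-refl
             x (x ^ toℕ j) v (v ^ suc (toℕ j))) ⟩
      sum {suc s} (λ j → x * v * t j)
        ≈⟨ *-distribˡ-sum (x * v) t ⟨
      x * v * σ  ∎

  -- The left side is the shape in which the series for `s = 0` arises from two rounds of partial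
  -- sums. The variable `c` stands for the constant series 2.
  partialGeometric-zero : ∀ v x c →
    v * (1# + v * (x * (1# + x * (1# + x * (c + x * c))))) ≈
    partialGeometric v x ((1# + x) * (1# + c * x ^ 2)) 0
  partialGeometric-zero = solve 3 (λ v x c →
    v :* (con 1 :+ v :* (x :* (con 1 :+ x :* (con 1 :+ x :* (c :+ x :* c))))) :=
    con 1 :* (v :* con 1) :+ con 0 :+
    (x :* con 1) :* ((con 1 :+ x) :* (con 1 :+ c :* (x :* (x :* con 1)))) :* (v :* (v :* con 1))) ≋-refl

  -- Passes between quotients and powers of `v`: here `w k` is to be the inverse of the `k`-th power
  -- of `1# - x`, and the numerator is a product of three factors associated to the left.
  partialGeometric-cong : ∀ {v x p q} (w : ℕ → Carrier) → (∀ k → w k ≈ v ^ k) → ∀ s →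
    sum {suc s} (λ j → x ^ toℕ j * w (suc (toℕ j))) + x ^ suc s * p * q * w (suc (suc s)) ≈
    partialGeometric v x (p * q) s
  partialGeometric-cong {v} {x} {p} {q} w w≈ s = +-cong
    (sum-cong-≋ {suc s} λ j → *-congˡ {x ^ toℕ j} (w≈ (suc (toℕ j))))
    (*-cong (*-assoc (x ^ suc s) p q) (w≈ (suc (suc s))))

open import Defs

private
  variable
    n : ℕ
    c d : Letter
    ℓ ℓ′ : Level
    P : Pred (Word n) ℓ
    Q : Pred (Word n) ℓ′

-- Counting isolated words

∈-words : (w : Word n) → w ∈ words n
∈-words []      = here refl
∈-words (a ∷ w) = ∈-++⁺ˡ (∈-map⁺ (a ∷_) (∈-words w))
∈-words (b ∷ w) = ∈-++⁺ʳ _ (∈-map⁺ (b ∷_) (∈-words w))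

words-! : ∀ n → Unique (words n)
words-! zero    = All.[] ∷ []
words-! (suc n) = Unique.++⁺
  (Unique.map⁺ Vec.∷-injectiveʳ (words-! n))
  (Unique.map⁺ Vec.∷-injectiveʳ (words-! n))
  λ (∈a , ∈b) → case-disjoint (∈-map⁻ (a ∷_) ∈a) (∈-map⁻ (b ∷_) ∈b)
  where
  case-disjoint : ∀ {w} {us vs : List (Word n)} →
    ∃[ u ] (u ∈ us × w ≡ a ∷ u) → ∃[ v ] (v ∈ vs × w ≡ b ∷ v) → _
  case-disjoint (_ , _ , refl) (_ , _ , ())

# : {P : Pred (Word n) ℓ} → Decidable P → ℕ
# {n} P? = length (filter P? (words n))

#-cong : (P? : Decidable P) (Q? : Decidable Q) → P ≐ Q → # P? ≡ # Q?
#-cong P? Q? P≐Q = cong length (List.filter-≐ P? Q? P≐Q (words _))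

#-none : (P? : Decidable P) → (∀ w → P w → ⊥) → # P? ≡ 0
#-none P? ¬P = cong length (List.filter-none P? (All.universal ¬P (words _)))

length-filter-map : ∀ {A B : Set} {P : Pred B ℓ} (P? : Decidable P) (f : A → B) xs →
  length (filter P? (List.map f xs)) ≡ length (filter (P? ∘ f) xs)
length-filter-map P? f []       = refl
length-filter-map P? f (x ∷ xs) with does (P? (f x))
... | true  = cong suc (length-filter-map P? f xs)
... | false = length-filter-map P? f xs

#-∷ : {P : Pred (Word (suc n)) ℓ} (P? : Decidable P) →
  # P? ≡ # (P? ∘ (a ∷_)) ℕ.+ # (P? ∘ (b ∷_))
#-∷ {n} P? = begin
  length (filter P? (as ++ bs))                    ≡⟨ cong length (List.filter-++ P? as bs) ⟩
  length (filter P? as ++ filter P? bs)            ≡⟨ List.length-++ (filter P? as) ⟩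
  length (filter P? as) ℕ.+ length (filter P? bs)  ≡⟨ cong₂ ℕ._+_ (length-filter-map P? (a ∷_) (words n)) (length-filter-map P? (b ∷_) (words n)) ⟩
  # (P? ∘ (a ∷_)) ℕ.+ # (P? ∘ (b ∷_))              ∎
  where
  open ≡-Reasoning
  as bs : List (Word (suc n))
  as = List.map (a ∷_) (words n)
  bs = List.map (b ∷_) (words n)

#-∷ʳ : {P : Pred (Word (suc n)) ℓ} (P? : Decidable P) →
  # P? ≡ # (P? ∘ (_∷ʳ a)) ℕ.+ # (P? ∘ (_∷ʳ b))
#-∷ʳ {zero}  P? = trans (#-∷ P?) (cong₂ ℕ._+_
  (#-cong (P? ∘ (a ∷_)) (P? ∘ (_∷ʳ a)) ((λ { {[]} p → p }) , λ { {[]} p → p }))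
  (#-cong (P? ∘ (b ∷_)) (P? ∘ (_∷ʳ b)) ((λ { {[]} p → p }) , λ { {[]} p → p })))
#-∷ʳ {suc n} P? = begin
  -- Since `words` branches on the first letter, split by it first, then by the last letter
  -- inductively, and regroup the four counts.
  # P?                                 ≡⟨ #-∷ P? ⟩
  # (P? ∘ (a ∷_)) ℕ.+ # (P? ∘ (b ∷_))  ≡⟨ cong₂ ℕ._+_ (#-∷ʳ (P? ∘ (a ∷_))) (#-∷ʳ (P? ∘ (b ∷_))) ⟩
  (# (Pʳ a ∘ (a ∷_)) ℕ.+ # (Pʳ b ∘ (a ∷_))) ℕ.+
  (# (Pʳ a ∘ (b ∷_)) ℕ.+ # (Pʳ b ∘ (b ∷_)))  ≡⟨ interchange ℕ.+-commutativeSemigroup (# (Pʳ a ∘ (a ∷_))) _ _ _ ⟩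
  (# (Pʳ a ∘ (a ∷_)) ℕ.+ # (Pʳ a ∘ (b ∷_))) ℕ.+
  (# (Pʳ b ∘ (a ∷_)) ℕ.+ # (Pʳ b ∘ (b ∷_)))  ≡⟨ cong₂ ℕ._+_ (#-∷ (Pʳ a)) (#-∷ (Pʳ b)) ⟨
  # (Pʳ a) ℕ.+ # (Pʳ b)                      ∎
  where
  open ≡-Reasoning
  Pʳ : ∀ x → Decidable _
  Pʳ x = P? ∘ (_∷ʳ x)

Isolated : ℕ → Word n → Set
Isolated s w = ∀ u → u ≈[ s ] w → u ≡ w

≈-refl : ∀ s (w : Word n) → w ≈[ s ] w
≈-refl s w = (refl , refl) , refl

≈-sym : ∀ s (u w : Word n) → u ≈[ s ] w → w ≈[ s ] u
≈-sym s _ _ ((p , q) , r) = (sym p , sym q) , sym r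

w∈class[w] : ∀ s (w : Word n) → w ∈ class s w
w∈class[w] s w = ∈-filter⁺ (_≈[ s ]? w) (∈-words w) (≈-refl s w)

length≡1⇒≡[] : ∀ {A : Set} {x : A} {xs} → length xs ≡ 1 → x ∈ xs → xs ≡ [ x ]
length≡1⇒≡[] {xs = _ ∷ []} refl (here refl) = refl

-- Duplicate-free lists with the same members are permutations of each other.
unique-members⇒length≡ : ∀ {A : Set} {xs ys : List A} → Unique xs → Unique ys →
  (∀ {z} → z ∈ xs → z ∈ ys) → (∀ {z} → z ∈ ys → z ∈ xs) → length xs ≡ length ys
unique-members⇒length≡ xs! ys! to from =
  ↭-length (∼bag⇒↭ (unique∧set⇒bag xs! ys! (mk⇔ to from)))

class-isolated : ∀ s (w : Word n) → length (class s w) ≡ 1 → Isolated s w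
class-isolated s w eq u u≈w
  with u∈class ← ∈-filter⁺ (_≈[ s ]? w) (∈-words u) u≈w
  rewrite length≡1⇒≡[] eq (w∈class[w] s w)
  with here u≡w ← u∈class = u≡w

isolated-class : ∀ s (w : Word n) → Isolated s w → length (class s w) ≡ 1
isolated-class {n} s w iso = unique-members⇒length≡ (Unique.filter⁺ (_≈[ s ]? w) (words-! n)) (All.[] ∷ [])
  (λ u∈class → here (iso _ (proj₂ (∈-filter⁻ (_≈[ s ]? w) {xs = words n} u∈class))))
  λ { (here refl) → w∈class[w] s w }

isolated? : ∀ s → Decidable (Isolated {n} s)
isolated? s w = map′ (class-isolated s w) (isolated-class s w) (length (class s w) ℕ.≟ 1)

-- A class contains the word that defines it, so a one-element class is `[ w ]` with `w` isolated,
-- and conversely. Both lists compared are duplicate-free.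
S≡#isolated : ∀ s n → S s n ≡ # (isolated? {n} s)
S≡#isolated s n = trans
  (unique-members⇒length≡
    (Unique.filter⁺ length≟1 (deduplicate-! _≟ᶜ_ (List.map (class s) (words n))))
    (Unique.map⁺ List.∷-injectiveˡ (Unique.filter⁺ (isolated? s) (words-! n)))
    to from)
  (List.length-map [_] (filter (isolated? s) (words n)))
  where
  _≟ᶜ_ = List.≡-dec (_≟ʷ_ {n})
  length≟1 : Decidable (λ (c : List (Word n)) → length c ≡ 1)
  length≟1 c = length c ℕ.≟ 1

  to : ∀ {c} → c ∈ filter length≟1 (classes s n) → c ∈ List.map [_] (filter (isolated? s) (words n))
  to c∈ with ∈-filter⁻ length≟1 {xs = classes s n} c∈
  ... | c∈classes , eq with ∈-map⁻ (class s) (∈-deduplicate⁻ _≟ᶜ_ (List.map (class s) (words n)) c∈classes)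
  ... | w , w∈words , refl
    rewrite length≡1⇒≡[] eq (w∈class[w] s w) =
    ∈-map⁺ [_] (∈-filter⁺ (isolated? s) w∈words (class-isolated s w eq))

  from : ∀ {c} → c ∈ List.map [_] (filter (isolated? s) (words n)) → c ∈ filter length≟1 (classes s n)
  from c∈ with ∈-map⁻ [_] c∈
  ... | w , w∈ , refl with ∈-filter⁻ (isolated? s) {xs = words n} w∈
  ... | w∈words , iso = subst (_∈ filter length≟1 (classes s n))
    (length≡1⇒≡[] ∣class∣≡1 (w∈class[w] s w))
    (∈-filter⁺ length≟1 (∈-deduplicate⁺ _≟ᶜ_ (∈-map⁺ (class s) w∈words)) ∣class∣≡1)
    where ∣class∣≡1 = isolated-class s w iso

-- Appending a letter

count-∷ʳ : ∀ (w : Word n) x y → ∣ w ∷ʳ x ∣[ y ] ≡ ∣ w ∣[ y ] ℕ.+ ∣ x ∷ [] ∣[ y ]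
count-∷ʳ []      x y = refl
count-∷ʳ (z ∷ w) x y with does (z ≟ y)
... | true  = cong suc (count-∷ʳ w x y)
... | false = count-∷ʳ w x y

binom-letter : ∀ (w : Word n) x → binom w (x ∷ []) ≡ ∣ w ∣[ x ]
binom-letter []      x = refl
binom-letter (y ∷ w) x with does (y ≟ x)
... | true  = cong suc (binom-letter w x)
... | false = binom-letter w x

binom-∷ʳa : (w : Word n) → binom (w ∷ʳ a) ab ≡ binom w ab
binom-∷ʳa []      = refl
binom-∷ʳa (a ∷ w) = cong₂ ℕ._+_ (trans (binom-letter (w ∷ʳ a) b) (trans (count-∷ʳ w a b)
  (trans (ℕ.+-identityʳ _) (sym (binom-letter w b))))) (binom-∷ʳa w)
binom-∷ʳa (b ∷ w) = binom-∷ʳa w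

-- The new `b` completes one occurrence of `ab` with each `a` of `w`.
binom-∷ʳb : (w : Word n) → binom (w ∷ʳ b) ab ≡ ∣ w ∣[ a ] ℕ.+ binom w ab
binom-∷ʳb []      = refl
binom-∷ʳb (a ∷ w) = begin
  binom (w ∷ʳ b) (b ∷ []) ℕ.+ binom (w ∷ʳ b) ab             ≡⟨ cong₂ ℕ._+_ (trans (binom-letter (w ∷ʳ b) b) (count-∷ʳ w b b)) (binom-∷ʳb w) ⟩
  (∣ w ∣[ b ] ℕ.+ 1) ℕ.+ (∣ w ∣[ a ] ℕ.+ binom w ab)        ≡⟨ cong (λ k → (k ℕ.+ 1) ℕ.+ (∣ w ∣[ a ] ℕ.+ binom w ab)) (binom-letter w b) ⟨
  (binom w (b ∷ []) ℕ.+ 1) ℕ.+ (∣ w ∣[ a ] ℕ.+ binom w ab)  ≡⟨ lemma (binom w (b ∷ [])) ∣ w ∣[ a ] (binom w ab) ⟩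
  suc ∣ w ∣[ a ] ℕ.+ (binom w (b ∷ []) ℕ.+ binom w ab)      ∎
  where
  open ≡-Reasoning
  lemma : ∀ i j k → (i ℕ.+ 1) ℕ.+ (j ℕ.+ k) ≡ suc j ℕ.+ (i ℕ.+ k)
  lemma = ℕ-Solver.solve-∀
binom-∷ʳb (b ∷ w) = binom-∷ʳb w

rights-∷ʳa : (w : Word n) → rights (w ∷ʳ a) ≡ rights w ++ [ 0 ]
rights-∷ʳa []      = refl
rights-∷ʳa (a ∷ w) = cong₂ _∷_ (trans (count-∷ʳ w a b) (ℕ.+-identityʳ _)) (rights-∷ʳa w)
rights-∷ʳa (b ∷ w) = rights-∷ʳa w

rights-∷ʳb : (w : Word n) → rights (w ∷ʳ b) ≡ List.map suc (rights w)
rights-∷ʳb []      = refl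
rights-∷ʳb (a ∷ w) = cong₂ _∷_ (trans (count-∷ʳ w b b) (ℕ.+-comm _ 1)) (rights-∷ʳb w)
rights-∷ʳb (b ∷ w) = rights-∷ʳb w

-- The new `a` has no `b` to its right and comes first in the reversed list, so it takes one of the
-- `suc s` places and leaves `s` for `w`.
tail-∷ʳa : ∀ s (w : Word n) → tail (suc s) (w ∷ʳ a) ≡ 0 ∷ tail s w
tail-∷ʳa s w rewrite rights-∷ʳa w | List.reverse-++ (rights w) [ 0 ] = refl

-- Every `a` gains one `b` to its right.
tail-∷ʳb : ∀ s (w : Word n) → tail s (w ∷ʳ b) ≡ List.map suc (tail s w)
tail-∷ʳb s w rewrite rights-∷ʳb w | sym (List.reverse-map suc (rights w)) =
  List.take-map s (reverse (rights w))

module _ (s : ℕ) (u w : Word n) where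

  ∷ʳa-≈⁺ : u ≈[ s ] w → u ∷ʳ a ≈[ suc s ] w ∷ʳ a
  ∷ʳa-≈⁺ ((#a , #ab) , t)
    rewrite count-∷ʳ u a a | count-∷ʳ w a a | binom-∷ʳa u | binom-∷ʳa w | tail-∷ʳa s u | tail-∷ʳa s w =
    (cong (ℕ._+ 1) #a , #ab) , cong (0 ∷_) t

  ∷ʳa-≈⁻ : u ∷ʳ a ≈[ suc s ] w ∷ʳ a → u ≈[ s ] w
  ∷ʳa-≈⁻ ((#a , #ab) , t)
    rewrite count-∷ʳ u a a | count-∷ʳ w a a | binom-∷ʳa u | binom-∷ʳa w | tail-∷ʳa s u | tail-∷ʳa s w =
    (ℕ.+-cancelʳ-≡ 1 _ _ #a , #ab) , List.∷-injectiveʳ t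

  ∷ʳb-≈⁺ : u ≈[ s ] w → u ∷ʳ b ≈[ s ] w ∷ʳ b
  ∷ʳb-≈⁺ ((#a , #ab) , t)
    rewrite count-∷ʳ u b a | count-∷ʳ w b a | binom-∷ʳb u | binom-∷ʳb w | tail-∷ʳb s u | tail-∷ʳb s w =
    (cong (ℕ._+ 0) #a , cong₂ ℕ._+_ #a #ab) , cong (List.map suc) t

  ∷ʳb-≈⁻ : u ∷ʳ b ≈[ s ] w ∷ʳ b → u ≈[ s ] w
  ∷ʳb-≈⁻ ((#a , #ab) , t)
    rewrite count-∷ʳ u b a | count-∷ʳ w b a | binom-∷ʳb u | binom-∷ʳb w | tail-∷ʳb s u | tail-∷ʳb s w
    -- Equal numbers of `a` in `u` and `w` are the equal summands that have to be cancelled from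
    -- `#ab`.
    with #a′ ← ℕ.+-cancelʳ-≡ 0 _ _ #a =
    (#a′ , ℕ.+-cancelˡ-≡ _ _ _ (trans #ab (cong (ℕ._+ binom w ab) (sym #a′)))) , List.map-injective ℕ.suc-injective t

  ∷ʳa≉∷ʳb : u ∷ʳ a ≈[ suc s ] w ∷ʳ b → ⊥
  ∷ʳa≉∷ʳb (_ , t) rewrite tail-∷ʳa s u | tail-∷ʳb (suc s) w with tail (suc s) w
  ... | [] with () ← t
  ... | _ ∷ _ with () ← t

isolated-∷ʳa : ∀ n s → (Isolated {suc n} (suc s) ∘ (_∷ʳ a)) ≐ Isolated {n} s
isolated-∷ʳa n s =
  (λ {w} iso u u≈w → Vec.∷ʳ-injectiveˡ u w (iso (u ∷ʳ a) (∷ʳa-≈⁺ s u w u≈w))) ,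
  λ {w} iso u u≈w∷ʳa → lift w u iso (Vec.initLast u) u≈w∷ʳa
  where
  lift : ∀ (w : Word n) u → Isolated s w → ∃[ v ] ∃[ x ] u ≡ v ∷ʳ x → u ≈[ suc s ] w ∷ʳ a → u ≡ w ∷ʳ a
  lift w _ iso (v , a , refl) v∷ʳa≈w∷ʳa = cong (_∷ʳ a) (iso v (∷ʳa-≈⁻ s v w v∷ʳa≈w∷ʳa))
  lift w _ iso (v , b , refl) v∷ʳb≈w∷ʳa = contradiction (≈-sym (suc s) (v ∷ʳ b) (w ∷ʳ a) v∷ʳb≈w∷ʳa) (∷ʳa≉∷ʳb s w v)

isolated-∷ʳb : ∀ n s → (Isolated {suc n} (suc s) ∘ (_∷ʳ b)) ≐ Isolated {n} (suc s)
isolated-∷ʳb n s =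
  (λ {w} iso u u≈w → Vec.∷ʳ-injectiveˡ u w (iso (u ∷ʳ b) (∷ʳb-≈⁺ (suc s) u w u≈w))) ,
  λ {w} iso u u≈w∷ʳb → lift w u iso (Vec.initLast u) u≈w∷ʳb
  where
  lift : ∀ (w : Word n) u → Isolated (suc s) w → ∃[ v ] ∃[ x ] u ≡ v ∷ʳ x → u ≈[ suc s ] w ∷ʳ b → u ≡ w ∷ʳ b
  lift w _ iso (v , a , refl) v∷ʳa≈w∷ʳb = contradiction v∷ʳa≈w∷ʳb (∷ʳa≉∷ʳb s v w)
  lift w _ iso (v , b , refl) v∷ʳb≈w∷ʳb = cong (_∷ʳ b) (iso v (∷ʳb-≈⁻ (suc s) v w v∷ʳb≈w∷ʳb))

S[1+s,1+n] : ∀ s n → S (suc s) (suc n) ≡ S s n ℕ.+ S (suc s) n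
S[1+s,1+n] s n = begin
  S (suc s) (suc n)              ≡⟨ S≡#isolated (suc s) (suc n) ⟩
  # (isolated? {suc n} (suc s))  ≡⟨ #-∷ʳ (isolated? {suc n} (suc s)) ⟩
  # (isolated? {suc n} (suc s) ∘ (_∷ʳ a)) ℕ.+
  # (isolated? {suc n} (suc s) ∘ (_∷ʳ b))          ≡⟨ cong₂ ℕ._+_
      (#-cong (isolated? {suc n} (suc s) ∘ (_∷ʳ a)) (isolated? {n} s) (isolated-∷ʳa n s))
      (#-cong (isolated? {suc n} (suc s) ∘ (_∷ʳ b)) (isolated? {n} (suc s)) (isolated-∷ʳb n s)) ⟩
  # (isolated? {n} s) ℕ.+ # (isolated? {n} (suc s))  ≡⟨ cong₂ ℕ._+_ (S≡#isolated s n) (S≡#isolated (suc s) n) ⟨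
  S s n ℕ.+ S (suc s) n                              ∎
  where open ≡-Reasoning

-- Singleton classes of ∼₂

-- Abstracts over the naming of the letters, so that each argument is given once and covers both
-- possible first letters.
data Opposite : Letter → Letter → Set where
  a≁b : Opposite a b
  b≁a : Opposite b a

opposite-sym : Opposite c d → Opposite d c
opposite-sym a≁b = b≁a
opposite-sym b≁a = a≁b

-- The orientation d c (not c d) makes the number invariant under prepending c.
inv : Opposite c d → Word n → ℕ
inv {c} {d} _ w = binom w (d ∷ c ∷ [])

count-∷-same : Opposite c d → (w : Word n) → ∣ c ∷ w ∣[ c ] ≡ suc ∣ w ∣[ c ]
count-∷-same a≁b w = refl
count-∷-same b≁a w = refl

count-∷-opposite : Opposite c d → (w : Word n) → ∣ d ∷ w ∣[ c ] ≡ ∣ w ∣[ c ]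
count-∷-opposite a≁b w = refl
count-∷-opposite b≁a w = refl

inv-∷-same : (o : Opposite c d) (w : Word n) → inv o (c ∷ w) ≡ inv o w
inv-∷-same a≁b w = refl
inv-∷-same b≁a w = refl

inv-∷-opposite : (o : Opposite c d) (w : Word n) → inv o (d ∷ w) ≡ ∣ w ∣[ c ] ℕ.+ inv o w
inv-∷-opposite a≁b w = cong (ℕ._+ inv a≁b w) (binom-letter w a)
inv-∷-opposite b≁a w = cong (ℕ._+ inv b≁a w) (binom-letter w b)

count-total : Opposite c d → (w : Word n) → ∣ w ∣[ c ] ℕ.+ ∣ w ∣[ d ] ≡ n
count-total a≁b []      = refl
count-total a≁b (a ∷ w) = cong suc (count-total a≁b w)
count-total a≁b (b ∷ w) = trans (ℕ.+-suc ∣ w ∣[ a ] ∣ w ∣[ b ]) (cong suc (count-total a≁b w))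
count-total b≁a []      = refl
count-total b≁a (a ∷ w) = trans (ℕ.+-suc ∣ w ∣[ b ] ∣ w ∣[ a ]) (cong suc (count-total b≁a w))
count-total b≁a (b ∷ w) = cong suc (count-total b≁a w)

-- Each pair of an `a` and a `b` in `w` forms either an `ab` or a `ba`.
inv-total : (w : Word n) → inv b≁a w ℕ.+ inv a≁b w ≡ ∣ w ∣[ a ] ℕ.* ∣ w ∣[ b ]
inv-total []      = refl
inv-total (a ∷ w) rewrite inv-∷-opposite b≁a w =
  trans (ℕ.+-assoc ∣ w ∣[ b ] (inv b≁a w) _) (cong (∣ w ∣[ b ] ℕ.+_) (inv-total w))
inv-total (b ∷ w) rewrite inv-∷-opposite a≁b w = begin
  inv b≁a w ℕ.+ (∣ w ∣[ a ] ℕ.+ inv a≁b w)  ≡⟨ lemma (inv b≁a w) ∣ w ∣[ a ] (inv a≁b w) ⟩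
  ∣ w ∣[ a ] ℕ.+ (inv b≁a w ℕ.+ inv a≁b w)  ≡⟨ cong (∣ w ∣[ a ] ℕ.+_) (inv-total w) ⟩
  ∣ w ∣[ a ] ℕ.+ ∣ w ∣[ a ] ℕ.* ∣ w ∣[ b ]  ≡⟨ ℕ.*-suc ∣ w ∣[ a ] ∣ w ∣[ b ] ⟨
  ∣ w ∣[ a ] ℕ.* suc ∣ w ∣[ b ]             ∎
  where
  open ≡-Reasoning
  lemma : ∀ i j k → i ℕ.+ (j ℕ.+ k) ≡ j ℕ.+ (i ℕ.+ k)
  lemma = ℕ-Solver.solve-∀

inv-≤ : (o : Opposite c d) (w : Word n) → inv o w ≤ ∣ w ∣[ c ] ℕ.* ∣ w ∣[ d ]
inv-≤ a≁b w = subst (inv a≁b w ≤_) (inv-total w) (ℕ.m≤n+m _ _)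
inv-≤ b≁a w = subst (inv b≁a w ≤_) (trans (inv-total w) (ℕ.*-comm ∣ w ∣[ a ] _)) (ℕ.m≤m+n _ _)

count-complement : Opposite c d → (u w : Word n) → ∣ u ∣[ c ] ≡ ∣ w ∣[ c ] → ∣ u ∣[ d ] ≡ ∣ w ∣[ d ]
count-complement o u w #c = ℕ.+-cancelˡ-≡ ∣ u ∣[ _ ] _ _
  (trans (count-total o u) (trans (sym (count-total o w)) (cong (ℕ._+ ∣ w ∣[ _ ]) (sym #c))))

-- The length determines the count of the other letter, and `inv-total` the occurrences in the other
-- order. Hence either orientation carries the same information as `_∼₂_`; `∼-from` is the converse.
∼-to : (o : Opposite c d) (u w : Word n) → u ∼₂ w → ∣ u ∣[ c ] ≡ ∣ w ∣[ c ] × inv o u ≡ inv o w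
∼-to b≁a u w (#a , #ab) = count-complement a≁b u w #a , #ab
∼-to a≁b u w u∼w@(#a , #ab) = #a , ℕ.+-cancelˡ-≡ (inv b≁a u) _ _ (begin
  inv b≁a u ℕ.+ inv a≁b u    ≡⟨ inv-total u ⟩
  ∣ u ∣[ a ] ℕ.* ∣ u ∣[ b ]  ≡⟨ cong₂ ℕ._*_ #a (proj₁ (∼-to b≁a u w u∼w)) ⟩
  ∣ w ∣[ a ] ℕ.* ∣ w ∣[ b ]  ≡⟨ inv-total w ⟨
  inv b≁a w ℕ.+ inv a≁b w    ≡⟨ cong (ℕ._+ inv a≁b w) #ab ⟨
  inv b≁a u ℕ.+ inv a≁b w    ∎)
  where open ≡-Reasoning

∼-from : (o : Opposite c d) (u w : Word n) → ∣ u ∣[ c ] ≡ ∣ w ∣[ c ] → inv o u ≡ inv o w → u ∼₂ w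
∼-from b≁a u w #b #ab = count-complement b≁a u w #b , #ab
∼-from a≁b u w #a #ba = #a , ℕ.+-cancelʳ-≡ (inv a≁b u) _ _ (begin
  inv b≁a u ℕ.+ inv a≁b u    ≡⟨ inv-total u ⟩
  ∣ u ∣[ a ] ℕ.* ∣ u ∣[ b ]  ≡⟨ cong₂ ℕ._*_ #a (count-complement a≁b u w #a) ⟩
  ∣ w ∣[ a ] ℕ.* ∣ w ∣[ b ]  ≡⟨ inv-total w ⟨
  inv b≁a w ℕ.+ inv a≁b w    ≡⟨ cong (inv b≁a w ℕ.+_) #ba ⟨
  inv b≁a w ℕ.+ inv a≁b u    ∎)
  where open ≡-Reasoning

-- Words with prescribed counts and the first-letter criterion

replicate-count : Opposite c d → ∀ n → ∣ Vec.replicate n c ∣[ c ] ≡ n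
replicate-count o zero    = refl
replicate-count {c} o (suc n) = trans (count-∷-same o (Vec.replicate n c)) (cong suc (replicate-count o n))

replicate-inv : (o : Opposite c d) → ∀ n → inv o (Vec.replicate n c) ≡ 0
replicate-inv o zero    = refl
replicate-inv {c} o (suc n) = trans (inv-∷-same o (Vec.replicate n c)) (replicate-inv o n)

-- Greedy construction. If `p ≤ N`, a leading `d` uses up `p` occurrences, one for each `c`, and at
-- most `p * (q - 1)` remain. Otherwise a leading `c` costs nothing, and `N ≤ p - 1` is still within
-- reach because there is at least one `d`.
word-with : (o : Opposite c d) → ∀ p q N → p ℕ.+ q ≡ n → N ≤ p ℕ.* q →
  Σ[ u ∈ Word n ] ∣ u ∣[ c ] ≡ p × inv o u ≡ N
word-with {c} {n = n} o p zero N p+0≡n N≤0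
  with refl ← trans (sym (ℕ.+-identityʳ p)) p+0≡n
     | refl ← ℕ.n≤0⇒n≡0 (subst (N ≤_) (ℕ.*-zeroʳ p) N≤0) =
  Vec.replicate n c , replicate-count o n , replicate-inv o n
word-with {n = zero} o p (suc q) N p+q≡0 _ = contradiction (trans (sym p+q≡0) (ℕ.+-suc p q)) λ ()
word-with {c} {d} {n = suc n} o p (suc q) N p+q≡n N≤pq with p ℕ.≤? N
... | yes p≤N = d ∷ u , trans (count-∷-opposite o u) #c ,
      trans (inv-∷-opposite o u) (trans (cong₂ ℕ._+_ #c #dc) (ℕ.m+[n∸m]≡n p≤N))
  where
  N∸p≤pq : N ∸ p ≤ p ℕ.* q
  N∸p≤pq = ℕ.m≤n+o⇒m∸n≤o N p (subst (N ≤_) (ℕ.*-suc p q) N≤pq)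
  rec = word-with o p q (N ∸ p) (ℕ.suc-injective (trans (sym (ℕ.+-suc p q)) p+q≡n)) N∸p≤pq
  u = proj₁ rec
  #c = proj₁ (proj₂ rec)
  #dc = proj₂ (proj₂ rec)
word-with o zero (suc q) N p+q≡n N≤pq | no 0≰N = contradiction z≤n 0≰N
word-with {c} {d} {n = suc n} o (suc p) (suc q) N p+q≡n N≤pq | no p≰N =
  c ∷ u , trans (count-∷-same o u) (cong suc #c) , trans (inv-∷-same o u) #dc
  where
  N≤p : N ≤ p
  N≤p = ℕ.s≤s⁻¹ (ℕ.≰⇒> p≰N)
  rec = word-with o p (suc q) N (ℕ.suc-injective p+q≡n) (ℕ.≤-trans N≤p (ℕ.m≤m*n p (suc q)))
  u = proj₁ rec
  #c = proj₁ (proj₂ rec)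
  #dc = proj₂ (proj₂ rec)

-- A competitor starting with `c` reduces to a competitor of `w`. One starting with `d` has
-- `suc ∣ w ∣[ c ]` letters `c` after it, hence more occurrences of `dc` than the bound allows.
isolated-∷⁺ : (o : Opposite c d) (w : Word n) → Isolated 0 w → inv o w ≤ ∣ w ∣[ c ] → Isolated 0 (c ∷ w)
isolated-∷⁺ {c} {d} o w iso inv≤ (z ∷ u) (zu∼cw , _) = go (z≟ o z) (∼-to o (z ∷ u) (c ∷ w) zu∼cw)
  where
  z≟ : Opposite c d → ∀ z → (z ≡ c) ⊎ (z ≡ d)
  z≟ a≁b a = inj₁ refl
  z≟ a≁b b = inj₂ refl
  z≟ b≁a a = inj₂ refl
  z≟ b≁a b = inj₁ refl
  go : (z ≡ c) ⊎ (z ≡ d) → (∣ z ∷ u ∣[ c ] ≡ ∣ c ∷ w ∣[ c ]) × (inv o (z ∷ u) ≡ inv o (c ∷ w)) → z ∷ u ≡ c ∷ w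
  go (inj₁ refl) (#c , #dc)
    rewrite count-∷-same o u | count-∷-same o w | inv-∷-same o u | inv-∷-same o w =
    cong (c ∷_) (iso u (∼-from o u w (ℕ.suc-injective #c) #dc , refl))
  go (inj₂ refl) (#c , #dc)
    rewrite count-∷-opposite o u | count-∷-same o w | inv-∷-opposite o u | inv-∷-same o w | #c =
    contradiction (ℕ.≤-trans (ℕ.m≤m+n (suc ∣ w ∣[ c ]) (inv o u)) (ℕ.≤-trans (ℕ.≤-reflexive #dc) inv≤)) ℕ.1+n≰n

isolated-∷⁻ˡ : (o : Opposite c d) (w : Word n) → Isolated 0 (c ∷ w) → Isolated 0 w
isolated-∷⁻ˡ {c} o w iso u (u∼w , _) with #c , #dc ← ∼-to o u w u∼w =
  Vec.∷-injectiveʳ (iso (c ∷ u) (∼-from o (c ∷ u) (c ∷ w)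
    (trans (count-∷-same o u) (trans (cong suc #c) (sym (count-∷-same o w))))
    (trans (inv-∷-same o u) (trans #dc (sym (inv-∷-same o w)))) , refl))

-- If the bound fails there is a competitor `d ∷ u`: take `u` with one `c` more and one `d` fewer
-- than `w`. Its leading `d` accounts for `suc p` occurrences, and `word-with` supplies the rest.
isolated-∷⁻ʳ : (o : Opposite c d) (w : Word n) → Isolated 0 (c ∷ w) → inv o w ≤ ∣ w ∣[ c ]
isolated-∷⁻ʳ {c} {d} {n} o w iso = ℕ.≮⇒≥ λ p<inv → go p<inv ∣ w ∣[ d ] refl
  where
  p = ∣ w ∣[ c ]
  d≢c : Opposite c d → d ≡ c → ⊥
  d≢c a≁b ()
  d≢c b≁a ()
  go : p < inv o w → ∀ q → ∣ w ∣[ d ] ≡ q → ⊥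
  go p<inv zero    q≡ = contradiction
    (ℕ.≤-trans p<inv (ℕ.≤-trans (inv-≤ o w) (ℕ.≤-reflexive (trans (cong (p ℕ.*_) q≡) (ℕ.*-zeroʳ p))))) λ ()
  go p<inv (suc q) q≡ = d≢c o (Vec.∷-injectiveˡ (iso (d ∷ u) (∼-from o (d ∷ u) (c ∷ w)
      (trans (count-∷-opposite o u) (trans #c (sym (count-∷-same o w))))
      (begin
        inv o (d ∷ u)                ≡⟨ inv-∷-opposite o u ⟩
        ∣ u ∣[ c ] ℕ.+ inv o u       ≡⟨ cong₂ ℕ._+_ #c #dc ⟩
        suc p ℕ.+ (inv o w ∸ suc p)  ≡⟨ ℕ.m+[n∸m]≡n p<inv ⟩
        inv o w                      ≡⟨ inv-∷-same o w ⟨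
        inv o (c ∷ w)                ∎) , refl)))
    where
    open ≡-Reasoning
    -- Here `inv o w` is at most `p * suc q`, that is `p + p * q`, which is at most
    -- `suc p + suc p * q`.
    bound : inv o w ∸ suc p ≤ suc p ℕ.* q
    bound = ℕ.m≤n+o⇒m∸n≤o (inv o w) (suc p) (ℕ.≤-trans (inv-≤ o w)
      (ℕ.≤-trans (ℕ.≤-reflexive (trans (cong (p ℕ.*_) q≡) (ℕ.*-suc p q)))
        (ℕ.+-mono-≤ (ℕ.n≤1+n p) (ℕ.*-monoˡ-≤ q (ℕ.n≤1+n p)))))
    rec = word-with {n = n} o (suc p) q (inv o w ∸ suc p)
      (trans (sym (ℕ.+-suc p q)) (trans (cong (p ℕ.+_) (sym q≡)) (count-total o w))) bound
    u = proj₁ rec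
    #c = proj₁ (proj₂ rec)
    #dc = proj₂ (proj₂ rec)

-- Recursive counts by the first letter for `s = 0`

isolated-∷ : (o : Opposite c d) →
  (Isolated 0 ∘ (c ∷_)) ≐ (λ (w : Word n) → Isolated 0 w × inv o w ≤ ∣ w ∣[ c ])
isolated-∷ o = (λ {w} iso → isolated-∷⁻ˡ o w iso , isolated-∷⁻ʳ o w iso) ,
  λ {w} (iso , inv≤) → isolated-∷⁺ o w iso inv≤

#-∷-opposite : Opposite c d → {P : Pred (Word (suc n)) 0ℓ} (P? : Decidable P) →
  # P? ≡ # (P? ∘ (c ∷_)) ℕ.+ # (P? ∘ (d ∷_))
#-∷-opposite a≁b P? = #-∷ P?
#-∷-opposite b≁a P? = trans (#-∷ P?) (ℕ.+-comm (# (P? ∘ (a ∷_))) _)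

-- By isolated-∷, Few holds for w iff c ∷ w is isolated, and for the opposite
-- orientation iff d ∷ w is. Stripping a letter turns each of Few, FewFree and
-- FreeFree into others of this list, down to Missing, which only dⁿ satisfies.
Few Free Missing : Opposite c d → Word n → Set
Few     {c = c} o w = Isolated 0 w × inv o w ≤ ∣ w ∣[ c ]
Free            o w = inv o w ≡ 0
Missing {c = c} o w = Isolated 0 w × ∣ w ∣[ c ] ≡ 0

FewFree FreeFree : Opposite c d → Word n → Set
FewFree  o w = Few (opposite-sym o) w × Free o w
FreeFree o w = Isolated 0 w × Free (opposite-sym o) w × Free o w

few? : (o : Opposite c d) → Decidable (Few {n = n} o)
few? o w = isolated? 0 w ×-dec (inv o w ℕ.≤? _)

missing? : (o : Opposite c d) → Decidable (Missing {n = n} o)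
missing? o w = isolated? 0 w ×-dec (_ ℕ.≟ 0)

fewFree? : (o : Opposite c d) → Decidable (FewFree {n = n} o)
fewFree? o w = few? (opposite-sym o) w ×-dec (inv o w ℕ.≟ 0)

freeFree? : (o : Opposite c d) → Decidable (FreeFree {n = n} o)
freeFree? o w = isolated? 0 w ×-dec (inv (opposite-sym o) w ℕ.≟ 0) ×-dec (inv o w ℕ.≟ 0)

count≡0⇒inv≡0ˡ : (o : Opposite c d) (w : Word n) → ∣ w ∣[ c ] ≡ 0 → inv o w ≡ 0
count≡0⇒inv≡0ˡ {d = d} o w #c = ℕ.n≤0⇒n≡0 (subst (λ k → inv o w ≤ k ℕ.* ∣ w ∣[ d ]) #c (inv-≤ o w))

count≡0⇒inv≡0ʳ : (o : Opposite c d) (w : Word n) → ∣ w ∣[ d ] ≡ 0 → inv o w ≡ 0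
count≡0⇒inv≡0ʳ {c} o w #d = ℕ.n≤0⇒n≡0 (ℕ.≤-trans (inv-≤ o w)
  (ℕ.≤-reflexive (trans (cong (∣ w ∣[ c ] ℕ.*_) #d) (ℕ.*-zeroʳ ∣ w ∣[ c ]))))

≡0⇒≤ : ∀ {i j} → i ≡ 0 → i ≤ j
≡0⇒≤ refl = z≤n

module _ {c d : Letter} (o : Opposite c d) where

  private
    o′ : Opposite d c
    o′ = opposite-sym o

  missing-∷ : (Missing o ∘ (d ∷_)) ≐ Missing {n = n} o
  missing-∷ =
    (λ {w} (iso , #c) → isolated-∷⁻ˡ o′ w iso , trans (sym (count-∷-opposite o w)) #c) ,
    λ {w} (iso , #c) →
      isolated-∷⁺ o′ w iso (≡0⇒≤ (count≡0⇒inv≡0ʳ o′ w #c)) ,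
      trans (count-∷-opposite o w) #c

  #-missing : ∀ n → # (missing? {n = n} o) ≡ 1
  #-missing zero    = refl
  #-missing (suc n) = begin
    # (missing? {n = suc n} o)    ≡⟨ #-∷-opposite o (missing? {n = suc n} o) ⟩
    # (missing? {n = suc n} o ∘ (c ∷_)) ℕ.+ # (missing? {n = suc n} o ∘ (d ∷_))
      ≡⟨ cong₂ ℕ._+_
           (#-none (missing? {n = suc n} o ∘ (c ∷_)) λ w (_ , #c) → contradiction (trans (sym (count-∷-same o w)) #c) λ ())
           (#-cong (missing? {n = suc n} o ∘ (d ∷_)) (missing? {n = n} o) missing-∷) ⟩
    # (missing? {n = n} o)  ≡⟨ #-missing n ⟩
    1                       ∎
    where open ≡-Reasoning

  -- A word with neither `cd` nor `dc` is a power of one letter: behind a leading `c`, any `d` would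
  -- create a `cd`.
  freeFree-∷ : (FreeFree o ∘ (c ∷_)) ≐ Missing {n = n} o′
  freeFree-∷ =
    (λ {w} (iso , ff , f) → isolated-∷⁻ˡ o w iso ,
      ℕ.m+n≡0⇒m≡0 _ (trans (sym (inv-∷-opposite o′ w)) ff)) ,
    λ {w} (iso , #d) →
      isolated-∷⁺ o w iso (≡0⇒≤ (count≡0⇒inv≡0ʳ o w #d)) ,
      trans (inv-∷-opposite o′ w) (cong₂ ℕ._+_ #d (count≡0⇒inv≡0ˡ o′ w #d)) ,
      trans (inv-∷-same o w) (count≡0⇒inv≡0ʳ o w #d)

  -- The leading `c` adds `∣ w ∣[ d ]` occurrences of `cd`, which exhausts the bound, so `w` itself
  -- must have none.
  fewFree-∷-same : (FewFree o ∘ (c ∷_)) ≐ FreeFree {n = n} o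
  fewFree-∷-same =
    (λ {w} ((iso , few) , f) → isolated-∷⁻ˡ o w iso ,
      ℕ.n≤0⇒n≡0 (ℕ.+-cancelˡ-≤ ∣ w ∣[ d ] _ _ (begin
        ∣ w ∣[ d ] ℕ.+ inv o′ w  ≡⟨ inv-∷-opposite o′ w ⟨
        inv o′ (c ∷ w)           ≤⟨ few ⟩
        ∣ c ∷ w ∣[ d ]           ≡⟨ count-∷-opposite o′ w ⟩
        ∣ w ∣[ d ]               ≡⟨ ℕ.+-identityʳ _ ⟨
        ∣ w ∣[ d ] ℕ.+ 0         ∎)) ,
      trans (sym (inv-∷-same o w)) f) ,
    λ {w} (iso , ff , f) →
      (isolated-∷⁺ o w iso (≡0⇒≤ f) , (begin
        inv o′ (c ∷ w)           ≡⟨ inv-∷-opposite o′ w ⟩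
        ∣ w ∣[ d ] ℕ.+ inv o′ w  ≡⟨ cong (∣ w ∣[ d ] ℕ.+_) ff ⟩
        ∣ w ∣[ d ] ℕ.+ 0         ≡⟨ ℕ.+-identityʳ _ ⟩
        ∣ w ∣[ d ]               ≡⟨ count-∷-opposite o′ w ⟨
        ∣ c ∷ w ∣[ d ]           ∎)) ,
      trans (inv-∷-same o w) f
    where open ℕ.≤-Reasoning

  -- Behind a leading `d`, any `c` would create a `dc`. Without `c` all the other conditions hold
  -- trivially.
  fewFree-∷-opposite : (FewFree o ∘ (d ∷_)) ≐ Missing {n = n} o
  fewFree-∷-opposite =
    (λ {w} ((iso , few) , f) → isolated-∷⁻ˡ o′ w iso ,
      ℕ.m+n≡0⇒m≡0 _ (trans (sym (inv-∷-opposite o w)) f)) ,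
    λ {w} (iso , #c) →
      (isolated-∷⁺ o′ w iso (≡0⇒≤ (count≡0⇒inv≡0ʳ o′ w #c)) ,
       ≡0⇒≤ (trans (inv-∷-same o′ w) (count≡0⇒inv≡0ʳ o′ w #c))) ,
      trans (inv-∷-opposite o w) (cong₂ ℕ._+_ #c (count≡0⇒inv≡0ˡ o w #c))

  -- Isolation of `c ∷ w` already forces the bound on `w`; the leading `c` adds no `dc` and only
  -- relaxes the bound.
  few-∷-same : (Few o ∘ (c ∷_)) ≐ Few {n = n} o
  few-∷-same =
    (λ {w} (iso , _) → isolated-∷⁻ˡ o w iso , isolated-∷⁻ʳ o w iso) ,
    λ {w} (iso , few) → isolated-∷⁺ o w iso few , (begin
      inv o (c ∷ w)   ≡⟨ inv-∷-same o w ⟩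
      inv o w         ≤⟨ few ⟩
      ∣ w ∣[ c ]      ≤⟨ ℕ.n≤1+n _ ⟩
      suc ∣ w ∣[ c ]  ≡⟨ count-∷-same o w ⟨
      ∣ c ∷ w ∣[ c ]  ∎)
    where open ℕ.≤-Reasoning

  -- The leading `d` adds `∣ w ∣[ c ]` occurrences of `dc`, which exhausts the bound, so `w` has
  -- none; isolation of `d ∷ w` contributes the bound for the reversed orientation.
  few-∷-opposite : (Few o ∘ (d ∷_)) ≐ FewFree {n = n} o
  few-∷-opposite =
    (λ {w} (iso , few) → (isolated-∷⁻ˡ o′ w iso , isolated-∷⁻ʳ o′ w iso) ,
      ℕ.n≤0⇒n≡0 (ℕ.+-cancelˡ-≤ ∣ w ∣[ c ] _ _ (begin
        ∣ w ∣[ c ] ℕ.+ inv o w  ≡⟨ inv-∷-opposite o w ⟨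
        inv o (d ∷ w)           ≤⟨ few ⟩
        ∣ d ∷ w ∣[ c ]          ≡⟨ count-∷-opposite o w ⟩
        ∣ w ∣[ c ]              ≡⟨ ℕ.+-identityʳ _ ⟨
        ∣ w ∣[ c ] ℕ.+ 0        ∎))) ,
    λ {w} ((iso , few′) , f) → isolated-∷⁺ o′ w iso few′ , (begin
      inv o (d ∷ w)           ≡⟨ inv-∷-opposite o w ⟩
      ∣ w ∣[ c ] ℕ.+ inv o w  ≡⟨ cong (∣ w ∣[ c ] ℕ.+_) f ⟩
      ∣ w ∣[ c ] ℕ.+ 0        ≡⟨ ℕ.+-identityʳ _ ⟩
      ∣ w ∣[ c ]              ≡⟨ count-∷-opposite o w ⟨
      ∣ d ∷ w ∣[ c ]          ∎)
    where open ℕ.≤-Reasoning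

module _ {c d : Letter} (o : Opposite c d) where

  private
    o′ : Opposite d c
    o′ = opposite-sym o

  freeFree-∷-opposite : (FreeFree o ∘ (d ∷_)) ≐ Missing {n = n} o
  freeFree-∷-opposite =
    -- Reversal swaps the two freeness conditions. Since `inv` depends on the letters alone,
    -- reversing twice changes nothing.
    (λ {w} (iso , ff , f) → proj₁ (freeFree-∷ o′) (iso , f , ff)) ,
    λ {w} m → let iso , f , ff = proj₂ (freeFree-∷ o′) m in iso , ff , f

  #-split : {P : Pred (Word (suc n)) 0ℓ} {Q R : Pred (Word n) 0ℓ}
    (P? : Decidable P) (Q? : Decidable Q) (R? : Decidable R) →
    (P ∘ (c ∷_)) ≐ Q → (P ∘ (d ∷_)) ≐ R → # P? ≡ # Q? ℕ.+ # R?
  #-split P? Q? R? P≐Q P≐R = trans (#-∷-opposite o P?)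
    (cong₂ ℕ._+_ (#-cong (P? ∘ (c ∷_)) Q? P≐Q) (#-cong (P? ∘ (d ∷_)) R? P≐R))

  #-freeFree : ∀ n → # (freeFree? {n = suc n} o) ≡ 2
  #-freeFree n = trans
    (#-split (freeFree? {n = suc n} o) (missing? {n = n} o′) (missing? {n = n} o) (freeFree-∷ o) freeFree-∷-opposite)
    -- The powers of `c` and of `d`, which differ because the length is positive.
    (cong₂ ℕ._+_ (#-missing o′ n) (#-missing o n))

  #-fewFree : ∀ n → # (fewFree? {n = suc (suc n)} o) ≡ 3
  #-fewFree n = trans
    (#-split (fewFree? {n = suc (suc n)} o) (freeFree? {n = suc n} o) (missing? {n = suc n} o)
       (fewFree-∷-same o) (fewFree-∷-opposite o))
    -- The three words are the power of `c`, a `c` followed by a power of `d`, and the power of `d`.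
    (cong₂ ℕ._+_ (#-freeFree n) (#-missing o (suc n)))

  #-few : ∀ n → # (few? {n = 3 ℕ.+ n} o) ≡ # (few? {n = 2 ℕ.+ n} o) ℕ.+ 3
  #-few n = trans
    (#-split (few? {n = 3 ℕ.+ n} o) (few? {n = 2 ℕ.+ n} o) (fewFree? {n = 2 ℕ.+ n} o)
       (few-∷-same o) (few-∷-opposite o))
    (cong (# (few? {n = 2 ℕ.+ n} o) ℕ.+_) (#-fewFree n))

S[0,1+n] : ∀ n → S 0 (suc n) ≡ # (few? {n = n} a≁b) ℕ.+ # (few? {n = n} b≁a)
S[0,1+n] n = trans (S≡#isolated 0 (suc n))
  (#-split a≁b (isolated? {suc n} 0) (few? {n = n} a≁b) (few? {n = n} b≁a) (isolated-∷ a≁b) (isolated-∷ b≁a))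

-- Each of the two first letters contributes 3. The recursion for `few?` starts at length 3, hence
-- this one at length 4.
S[0,4+n] : ∀ n → S 0 (4 ℕ.+ n) ≡ S 0 (3 ℕ.+ n) ℕ.+ 6
S[0,4+n] n = begin
  S 0 (4 ℕ.+ n)                          ≡⟨ S[0,1+n] (3 ℕ.+ n) ⟩
  few₃ a≁b ℕ.+ few₃ b≁a                  ≡⟨ cong₂ ℕ._+_ (#-few a≁b n) (#-few b≁a n) ⟩
  (few₂ a≁b ℕ.+ 3) ℕ.+ (few₂ b≁a ℕ.+ 3)  ≡⟨ interchange ℕ.+-commutativeSemigroup (few₂ a≁b) 3 (few₂ b≁a) 3 ⟩
  (few₂ a≁b ℕ.+ few₂ b≁a) ℕ.+ 6          ≡⟨ cong (ℕ._+ 6) (S[0,1+n] (2 ℕ.+ n)) ⟨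
  S 0 (3 ℕ.+ n) ℕ.+ 6                    ∎
  where
  open ≡-Reasoning
  few₂ few₃ : Opposite c d → ℕ
  few₂ o = # (few? {n = 2 ℕ.+ n} o)
  few₃ o = # (few? {n = 3 ℕ.+ n} o)

-- The semiring of power series

shift : Series → Series
shift f = f ∘ suc

*-congˢ : ∀ {f f′ g g′} → f ≗ f′ → g ≗ g′ → f * g ≗ f′ * g′
*-congˢ f≗ g≗ zero    = cong₂ (λ i j → i ℤ.* j ℤ.+ 0ℤ) (f≗ 0) (g≗ 0)
*-congˢ f≗ g≗ (suc n) = cong₂ ℤ._+_ (cong₂ ℤ._*_ (f≗ 0) (g≗ (suc n))) (*-congˢ (f≗ ∘ suc) g≗ n)

-- The shift of `f * g` is `f 0` times `shift g` plus `shift f * g`; linearity in this form drives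
-- the induction for associativity. The case `k = 1ℤ` is distributivity.
*-linear : ∀ k f g h n → ((λ i → k ℤ.* f i ℤ.+ g i) * h) n ≡ k ℤ.* (f * h) n ℤ.+ (g * h) n
*-linear k f g h zero    = lemma k (f 0) (g 0) (h 0)
  where
  lemma : ∀ k f g h → (k ℤ.* f ℤ.+ g) ℤ.* h ℤ.+ 0ℤ ≡ k ℤ.* (f ℤ.* h ℤ.+ 0ℤ) ℤ.+ (g ℤ.* h ℤ.+ 0ℤ)
  lemma = ℤ-Solver.solve-∀
*-linear k f g h (suc n) = trans
  (cong (λ i → (k ℤ.* f 0 ℤ.+ g 0) ℤ.* h (suc n) ℤ.+ i) (*-linear k (shift f) (shift g) h n))
  (lemma k (f 0) (g 0) (h (suc n)) ((shift f * h) n) ((shift g * h) n))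
  where
  lemma : ∀ k f g h F G →
    (k ℤ.* f ℤ.+ g) ℤ.* h ℤ.+ (k ℤ.* F ℤ.+ G) ≡ k ℤ.* (f ℤ.* h ℤ.+ F) ℤ.+ (g ℤ.* h ℤ.+ G)
  lemma = ℤ-Solver.solve-∀

*-assocˢ : ∀ f g h → (f * g) * h ≗ f * (g * h)
*-assocˢ f g h zero    = lemma (f 0) (g 0) (h 0)
  where
  lemma : ∀ f g h → (f ℤ.* g ℤ.+ 0ℤ) ℤ.* h ℤ.+ 0ℤ ≡ f ℤ.* (g ℤ.* h ℤ.+ 0ℤ) ℤ.+ 0ℤ
  lemma = ℤ-Solver.solve-∀
*-assocˢ f g h (suc n) = begin
  (f 0 ℤ.* g 0 ℤ.+ 0ℤ) ℤ.* h (suc n) ℤ.+ (shift (f * g) * h) n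
    ≡⟨ cong (λ i → (f * g) 0 ℤ.* h (suc n) ℤ.+ i) (*-linear (f 0) (shift g) (shift f * g) h n) ⟩
  (f 0 ℤ.* g 0 ℤ.+ 0ℤ) ℤ.* h (suc n) ℤ.+ (f 0 ℤ.* (shift g * h) n ℤ.+ ((shift f * g) * h) n)
    ≡⟨ cong (λ i → (f * g) 0 ℤ.* h (suc n) ℤ.+ (f 0 ℤ.* (shift g * h) n ℤ.+ i)) (*-assocˢ (shift f) g h n) ⟩
  (f 0 ℤ.* g 0 ℤ.+ 0ℤ) ℤ.* h (suc n) ℤ.+ (f 0 ℤ.* (shift g * h) n ℤ.+ (shift f * (g * h)) n)
    ≡⟨ lemma (f 0) (g 0) (h (suc n)) _ _ ⟩
  f 0 ℤ.* (g 0 ℤ.* h (suc n) ℤ.+ (shift g * h) n) ℤ.+ (shift f * (g * h)) n ∎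
  where
  open ≡-Reasoning
  lemma : ∀ f g h F G → (f ℤ.* g ℤ.+ 0ℤ) ℤ.* h ℤ.+ (f ℤ.* F ℤ.+ G) ≡ f ℤ.* (g ℤ.* h ℤ.+ F) ℤ.+ G
  lemma = ℤ-Solver.solve-∀

-- The product unfolds at its first summand; commutativity needs it split at the last one as well.
*-lastʳ : ∀ f g n → (f * g) (suc n) ≡ f (suc n) ℤ.* g 0 ℤ.+ (f * shift g) n
*-lastʳ f g zero    = lemma (f 0) (f 1) (g 0) (g 1)
  where
  lemma : ∀ f f₁ g g₁ → f ℤ.* g₁ ℤ.+ (f₁ ℤ.* g ℤ.+ 0ℤ) ≡ f₁ ℤ.* g ℤ.+ (f ℤ.* g₁ ℤ.+ 0ℤ)
  lemma = ℤ-Solver.solve-∀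
*-lastʳ f g (suc n) = trans
  (cong (λ i → f 0 ℤ.* g (suc (suc n)) ℤ.+ i) (*-lastʳ (shift f) g n))
  (lemma (f 0 ℤ.* g (suc (suc n))) (f (suc (suc n)) ℤ.* g 0) _)
  where
  lemma : ∀ i j k → i ℤ.+ (j ℤ.+ k) ≡ j ℤ.+ (i ℤ.+ k)
  lemma = ℤ-Solver.solve-∀

*-commˢ : ∀ f g → f * g ≗ g * f
*-commˢ f g zero    = cong (ℤ._+ 0ℤ) (ℤ.*-comm (f 0) (g 0))
*-commˢ f g (suc n) = begin
  f 0 ℤ.* g (suc n) ℤ.+ (shift f * g) n  ≡⟨ cong₂ ℤ._+_ (ℤ.*-comm (f 0) (g (suc n))) (*-commˢ (shift f) g n) ⟩
  g (suc n) ℤ.* f 0 ℤ.+ (g * shift f) n  ≡⟨ *-lastʳ g f n ⟨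
  (g * f) (suc n)                        ∎
  where open ≡-Reasoning

0#≗0 : ∀ n → 0# n ≡ 0ℤ
0#≗0 zero    = refl
0#≗0 (suc n) = refl

*-const : ∀ k f n → (const k * f) n ≡ k ℤ.* f n
*-const k f zero    = ℤ.+-identityʳ _
*-const k f (suc n) = trans
  -- The shift of `const k` vanishes in every coefficient, so the remaining sum is the case
  -- `k = 0ℤ`.
  (cong (λ i → k ℤ.* f (suc n) ℤ.+ i) (trans (*-congˢ {g = f} (sym ∘ 0#≗0) (λ _ → refl) n) (*-const 0ℤ f n)))
  (ℤ.+-identityʳ _)

*-distribʳˢ : ∀ h f g → (f + g) * h ≗ f * h + g * h
*-distribʳˢ h f g n = begin
  ((f + g) * h) n                     ≡⟨ *-congˢ {g = h} (λ i → cong (ℤ._+ g i) (ℤ.*-identityˡ (f i))) (λ _ → refl) n ⟨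
  ((λ i → 1ℤ ℤ.* f i ℤ.+ g i) * h) n  ≡⟨ *-linear 1ℤ f g h n ⟩
  1ℤ ℤ.* (f * h) n ℤ.+ (g * h) n      ≡⟨ cong (ℤ._+ (g * h) n) (ℤ.*-identityˡ ((f * h) n)) ⟩
  (f * h) n ℤ.+ (g * h) n             ∎
  where open ≡-Reasoning

commutativeSemiring : CommutativeSemiring 0ℓ 0ℓ
commutativeSemiring = record
  { Carrier = Series
  ; _≈_ = _≗_
  ; _+_ = _+_
  ; _*_ = _*_
  ; 0# = 0#
  ; 1# = 1#
  ; isCommutativeSemiring = isCommutativeSemiringˡ record
    { +-isCommutativeMonoid = record
      { isMonoid = record
        { isSemigroup = Pointwise.isSemigroup ℕ ℤ.+-isSemigroup
        ; identity = +-identityˡˢ , λ f n → trans (ℤ.+-comm (f n) (0# n)) (+-identityˡˢ f n)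
        }
      ; comm = λ f g n → ℤ.+-comm (f n) (g n)
      }
    ; *-isCommutativeMonoid = record
      { isMonoid = record
        { isSemigroup = record
          { isMagma = record
            { isEquivalence = Pointwise.isEquivalence ℕ isEquivalence
            ; ∙-cong = *-congˢ
            }
          ; assoc = *-assocˢ
          }
        ; identity = *-identityˡˢ , λ f n → trans (*-commˢ f 1# n) (*-identityˡˢ f n)
        }
      ; comm = *-commˢ
      }
    ; distribʳ = *-distribʳˢ
    ; zeroˡ = λ f n → trans (*-const 0ℤ f n) (sym (0#≗0 n))
    }
  }
  where
  +-identityˡˢ : ∀ f → 0# + f ≗ f
  +-identityˡˢ f n = trans (cong (ℤ._+ f n) (0#≗0 n)) (ℤ.+-identityˡ (f n))
  *-identityˡˢ : ∀ f → 1# * f ≗ f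
  *-identityˡˢ f n = trans (*-const 1ℤ f n) (ℤ.*-identityˡ (f n))

-- Generating functions from recurrences

open CommutativeSemiring commutativeSemiring using (setoid; +-congˡ; *-congˡ; *-identityˡ; *-identityʳ)
module ≗-Reasoning = SetoidReasoning setoid

x*-suc : ∀ f n → (x * f) (suc n) ≡ f n
x*-suc f n = trans (ℤ.+-identityˡ _) (*-identityˡ f n)

1+x*-suc : ∀ f n → (1# + x * f) (suc n) ≡ f n
1+x*-suc f n = trans (ℤ.+-identityˡ _) (x*-suc f n)

v : Series
v = inverse (1# - x)

[1-x]*-suc : ∀ f n → ((1# - x) * f) (suc n) ≡ f (suc n) ℤ.- f n
[1-x]*-suc f n = cong₂ ℤ._+_ (ℤ.*-identityˡ (f (suc n))) (trans (*-congˢ {g = f} shift≗ (λ _ → refl) n)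
  (trans (*-const -1ℤ f n) (ℤ.-1*i≡-i (f n))))
  where
  shift≗ : shift (1# - x) ≗ const -1ℤ
  shift≗ zero    = refl
  shift≗ (suc n) = refl

-- Multiplication by `1# - x` takes differences of successive coefficients, so a series with
-- differences `g` is `g` divided by `1# - x`.
partialSums : ∀ f g → f 0 ≡ g 0 → (∀ n → f (suc n) ≡ f n ℤ.+ g (suc n)) → f ≗ v * g
partialSums f g f₀ fₙ =
  *-solve commutativeSemiring {1# - x} {v} {f} {g} (*-inverseʳ (1# - x) refl) difference
  where
  difference : (1# - x) * f ≗ g
  difference zero    = trans (ℤ.+-identityʳ _) (trans (ℤ.*-identityˡ (f 0)) f₀)
  difference (suc n) = trans ([1-x]*-suc f n) (trans (cong (ℤ._- f n) (fₙ n)) (lemma (f n) (g (suc n))))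
    where
    lemma : ∀ i j → i ℤ.+ j ℤ.- i ≡ j
    lemma = ℤ-Solver.solve-∀

-- Both sides are inverse to the `k`-th power of `1# - x`.
inverse-^ : ∀ k → inverse ((1# - x) ^ k) ≗ v ^ k
inverse-^ k n = trans
  (*-solve commutativeSemiring {(1# - x) ^ k} {v ^ k} {inverse ((1# - x) ^ k)} {1#}
    (^-inverse commutativeSemiring {1# - x} {v} (*-inverseʳ (1# - x) refl) k)
    (*-inverseʳ ((1# - x) ^ k) ([1-x]^k₀≡1 k)) n)
  (*-identityʳ (v ^ k) n)

𝒮-suc : ∀ s → 𝒮 (suc s) ≗ v * (1# + x * 𝒮 s)
𝒮-suc s = partialSums (𝒮 (suc s)) (1# + x * 𝒮 s) refl λ n → begin
  + S (suc s) (suc n)                     ≡⟨ cong +_ (S[1+s,1+n] s n) ⟩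
  + S s n ℤ.+ + S (suc s) n               ≡⟨ ℤ.+-comm (+ S s n) (+ S (suc s) n) ⟩
  𝒮 (suc s) n ℤ.+ 𝒮 s n                   ≡⟨ cong (ℤ._+_ (𝒮 (suc s) n)) (1+x*-suc (𝒮 s) n) ⟨
  𝒮 (suc s) n ℤ.+ (1# + x * 𝒮 s) (suc n)  ∎
  where open ≡-Reasoning

-- x (1 + x) (1 + 2x²) in Horner form, so that coefficients are read off by x*-suc.
numerator : Series
numerator = x * (1# + x * (1# + x * (const (+ 2) + x * const (+ 2))))

-- The coefficients S 0 n - S 0 (n ∸ 1).
increments : Series
increments 0 = + 0
increments 1 = + 1
increments 2 = + 2
increments 3 = + 4
increments (suc (suc (suc (suc _)))) = + 6

increments≗ : increments ≗ v * numerator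
increments≗ = partialSums increments numerator refl step
  where
  numerator₅ : ∀ n → numerator (5 ℕ.+ n) ≡ 0ℤ
  numerator₅ n = begin
    numerator (5 ℕ.+ n)                              ≡⟨ x*-suc (1# + x * (1# + x * (two + x * two))) (4 ℕ.+ n) ⟩
    (1# + x * (1# + x * (two + x * two))) (4 ℕ.+ n)  ≡⟨ 1+x*-suc (1# + x * (two + x * two)) (3 ℕ.+ n) ⟩
    (1# + x * (two + x * two)) (3 ℕ.+ n)             ≡⟨ 1+x*-suc (two + x * two) (2 ℕ.+ n) ⟩
    (two + x * two) (2 ℕ.+ n)                        ≡⟨ ℤ.+-identityˡ _ ⟩
    (x * two) (2 ℕ.+ n)                              ≡⟨ x*-suc two (1 ℕ.+ n) ⟩
    0ℤ                                               ∎
    where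
    open ≡-Reasoning
    two : Series
    two = const (+ 2)
  step : ∀ n → increments (suc n) ≡ increments n ℤ.+ numerator (suc n)
  step 0 = refl
  step 1 = refl
  step 2 = refl
  step 3 = refl
  -- The numerator has degree 4, so from there on the increments stay at 6.
  step (suc (suc (suc (suc n)))) = sym (cong (ℤ._+_ (+ 6)) (numerator₅ n))

𝒮-zero : 𝒮 0 ≗ v * (1# + increments)
𝒮-zero = partialSums (𝒮 0) (1# + increments) refl step
  where
  step : ∀ n → 𝒮 0 (suc n) ≡ 𝒮 0 n ℤ.+ (1# + increments) (suc n)
  -- Direct evaluation: up to length 3 no two different words are equivalent, which gives the values
  -- 1, 2, 4, 8. The recurrence takes over at length 4.
  step 0 = refl
  step 1 = refl
  step 2 = refl
  step (suc (suc (suc n))) = cong +_ (S[0,4+n] n)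

𝒮≗partialGeometric : ∀ s → 𝒮 s ≗ partialGeometric commutativeSemiring v x ((1# + x) * (1# + const (+ 2) * x ^ 2)) s
𝒮≗partialGeometric zero = begin
  𝒮 0                                                                                 ≈⟨ 𝒮-zero ⟩
  v * (1# + increments)                                                               ≈⟨ *-congˡ {v} (+-congˡ {1#} increments≗) ⟩
  v * (1# + v * numerator)                                                            ≈⟨ partialGeometric-zero commutativeSemiring v x (const (+ 2)) ⟩
  partialGeometric commutativeSemiring v x ((1# + x) * (1# + const (+ 2) * x ^ 2)) 0  ∎
  where open ≗-Reasoning
𝒮≗partialGeometric (suc s) = begin
  𝒮 (suc s)                                                    ≈⟨ 𝒮-suc s ⟩
  v * (1# + x * 𝒮 s)                                           ≈⟨ *-congˡ {v} (+-congˡ {1#} (*-congˡ {x} (𝒮≗partialGeometric s))) ⟩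
  v * (1# + x * partialGeometric commutativeSemiring v x r s)  ≈⟨ partialGeometric-suc commutativeSemiring v x r s ⟨
  partialGeometric commutativeSemiring v x r (suc s)           ∎
  where
  open ≗-Reasoning
  r : Series
  r = (1# + x) * (1# + const (+ 2) * x ^ 2)

theorem6 : (s : ℕ) →
    𝒮 s ≗ sum {suc s} (λ j → x ^ toℕ j / (1# - x) ^ suc (toℕ j))
          + x ^ suc s * (1# + x) * (1# + const (+ 2) * x ^ 2) / (1# - x) ^ suc (suc s)
theorem6 s n = trans (𝒮≗partialGeometric s n)
  (sym (partialGeometric-cong commutativeSemiring {v} {x} {1# + x} {1# + const (+ 2) * x ^ 2}
    (λ k → inverse ((1# - x) ^ k)) inverse-^ s n))
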